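{- Let $n\ge 2$, $k\ge 2$ and let $G=W(n,k)$ be the windmill graph. Then for every integer $r\ge 2$, $\varphi(G^r)=\frac{1}{2}k(n-1)\bigl(k(n-1)-1\bigr)$.
   Context: All graphs are finite, simple and without isolated vertices. $\mathbb{N}_0$ denotes the set of non-negative integers; for finite $A,B\subseteq\mathbb{N}_0$, $A+B=\{a+b: a\in A, b\in B\}$. An integer additive set-indexer (IASI) of a graph $G$ is an injective map $f$ from $V(G)$ to the finite non-empty subsets of $\mathbb{N}_0$ such that the induced edge map $f^+(uv)=f(u)+f(v)$ is injective on $E(G)$. A weak IASI (WIASI) is an IASI $f$ with $|f^+(uv)|=\max(|f(u)|,|f(v)|)$ for every edge $uv$ (equivalently, for every edge at least one end vertex has a singleton label). A vertex or edge is mono-indexed if its set-label has cardinality $1$. Every graph admits a WIASI. The sparing number $\varphi(G)$ is the minimum, over all WIASIs of $G$, of the number of mono-indexed edges of $G$. The $r$-th power $G^r$ has vertex set $V(G)$, two distinct vertices being adjacent iff their distance in $G$ is at most $r$. The windmill graph $W(n,k)$ is obtained from $k$ copies of the complete graph $K_n$ by identifying one vertex from each copy into a single shared vertex. -}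

module Defs where

open import Data.Fin using (Fin)
import Data.Fin.Properties as Fin
open import Data.List using (List; []; _∷_; _++_; map; length; filter; deduplicate; cartesianProduct; cartesianProductWith; allFin)
open import Data.List.Membership.Propositional using (_∈_; find; lose)
open import Data.List.Membership.Propositional.Properties using (∈-map⁺; ∈-map⁻; ∈-cartesianProduct⁺; ∈-allFin)
open import Data.List.Relation.Binary.BagAndSetEquality using (_∼[_]_; set)
open import Data.List.Relation.Unary.All using (tabulate)
open import Data.List.Relation.Unary.AllPairs using (_∷_)
open import Data.List.Relation.Unary.Any using (any?; here; there)
open import Data.List.Relation.Unary.Unique.Propositional using (Unique)
open import Data.List.Relation.Unary.Unique.Propositional.Properties using (map⁺; cartesianProduct⁺; allFin⁺)
open import Data.Maybe using (Maybe; just; nothing)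
import Data.Maybe.Properties as Maybe
open import Data.Nat using (ℕ; zero; suc; _+_; _∸_; _⊔_; _≤_; _<_; s≤s; _≟_)
open import Data.Nat.Properties using (≤-pred; ≮⇒≥; <⇒≱; anyUpTo?; allUpTo?)
open import Data.Product using (∃; _×_; _,_)
import Data.Product.Properties as Product
open import Data.Sum using (_⊎_)
open import Function using (_∘_)
open import Relation.Binary using (Decidable; DecidableEquality; Symmetric; Irreflexive)
open import Relation.Binary.PropositionalEquality using (_≡_; _≢_; refl; sym)
open import Relation.Nullary using (Dec; yes; no; ¬_; map′; ¬?; _×-dec_)

record Graph : Set₁ where
  field
    Vertex     : Set
    _≟ᵛ_       : DecidableEquality Vertex
    vertices   : List Vertex
    unique     : Unique vertices
    complete   : ∀ v → v ∈ vertices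
    Adj        : Vertex → Vertex → Set
    adj?       : Decidable Adj
    adj-sym    : Symmetric Adj
    adj-irrefl : Irreflexive _≡_ Adj

-- For a duplicate-free list this contains each unordered pair of distinct
-- members exactly once.
unorderedPairs : ∀ {A : Set} → List A → List (A × A)
unorderedPairs []       = []
unorderedPairs (x ∷ xs) = map (x ,_) xs ++ unorderedPairs xs

-- Each edge is listed once, in one of its two orientations.
edges : (G : Graph) → List (Graph.Vertex G × Graph.Vertex G)
edges G = filter (λ (u , v) → adj? u v) (unorderedPairs vertices)
  where open Graph G

module _ (G : Graph) where
  open Graph G

  data Walk : ℕ → Vertex → Vertex → Set where
    []  : ∀ {u} → Walk zero u u
    _∷_ : ∀ {n u v w} → Adj u v → Walk n v w → Walk (suc n) u w

  -- Vertices in different components are at no distance (infinite distance).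
  IsDistance : Vertex → Vertex → ℕ → Set
  IsDistance u v d = Walk d u v × (∀ {e} → Walk e u v → d ≤ e)

  DistanceAtMost : ℕ → Vertex → Vertex → Set
  DistanceAtMost r u v = ∃ λ d → d ≤ r × IsDistance u v d

  snoc : ∀ {n u v w} → Walk n u v → Adj v w → Walk (suc n) u w
  snoc []      b = b ∷ []
  snoc (a ∷ p) b = a ∷ snoc p b

  reverse : ∀ {n u v} → Walk n u v → Walk n v u
  reverse []      = []
  reverse (a ∷ p) = snoc (reverse p) (adj-sym a)

  walk? : ∀ n u v → Dec (Walk n u v)
  walk? zero    u v = map′ (λ { refl → [] }) (λ { [] → refl }) (u ≟ᵛ v)
  walk? (suc n) u w = map′
    (λ p → let (_ , _ , a , q) = find {P = λ v → Adj u v × Walk n v w} p in a ∷ q)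
    (λ { (a ∷ q) → lose (complete _) (a , q) })
    (any? (λ v → adj? u v ×-dec walk? n v w) vertices)

  isDistance? : ∀ u v d → Dec (IsDistance u v d)
  isDistance? u v d = walk? d u v ×-dec map′
    {A = ∀ {e} → e < d → ¬ Walk e u v}
    (λ none {e} p → ≮⇒≥ λ e<d → none e<d p)
    (λ least {e} e<d p → <⇒≱ e<d (least p))
    (allUpTo? (λ e → ¬? (walk? e u v)) d)

  distanceAtMost? : ∀ r → Decidable (DistanceAtMost r)
  distanceAtMost? r u v = map′
    (λ (d , d<1+r , p) → d , ≤-pred d<1+r , p)
    (λ (d , d≤r , p) → d , s≤s d≤r , p)
    (anyUpTo? (isDistance? u v) (suc r))

  distanceAtMost-sym : ∀ r → Symmetric (DistanceAtMost r)
  distanceAtMost-sym r (d , d≤r , p , least) =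
    d , d≤r , reverse p , least ∘ reverse

power : Graph → ℕ → Graph
power G r = record
  { Vertex     = Vertex
  ; _≟ᵛ_       = _≟ᵛ_
  ; vertices   = vertices
  ; unique     = unique
  ; complete   = complete
  ; Adj        = λ u v → u ≢ v × DistanceAtMost G r u v
  ; adj?       = λ u v → ¬? (u ≟ᵛ v) ×-dec distanceAtMost? G r u v
  ; adj-sym    = λ (u≢v , p) → u≢v ∘ sym , distanceAtMost-sym G r p
  ; adj-irrefl = λ u≡v (u≢v , _) → u≢v u≡v
  }
  where open Graph G

-- The shared vertex, and for each of the k copies of K_n its n ∸ 1 other
-- vertices.  This is meaningful only for n ≥ 1.
WindmillVertex : ℕ → ℕ → Set
WindmillVertex n k = Maybe (Fin k × Fin (n ∸ 1))

pattern hub = nothing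
pattern blade i a = just (i , a)

data InCopy {n k : ℕ} (i : Fin k) : WindmillVertex n k → Set where
  hub∈   : InCopy i hub
  blade∈ : ∀ {a} → InCopy i (blade i a)

inCopy? : ∀ {n k} (i : Fin k) (v : WindmillVertex n k) → Dec (InCopy {n} i v)
inCopy? i hub = yes hub∈
inCopy? i (blade j a) with i Fin.≟ j
... | yes refl = yes blade∈
... | no i≢j   = no λ { blade∈ → i≢j refl }

windmill : ℕ → ℕ → Graph
windmill n k = record
  { Vertex     = WindmillVertex n k
  ; _≟ᵛ_       = _≟ʷ_
  ; vertices   = hub ∷ map just blades
  ; unique     = tabulate (λ v∈ → hub≢ (∈-map⁻ just v∈))
                 ∷ map⁺ Maybe.just-injective (cartesianProduct⁺ (allFin⁺ k) (allFin⁺ (n ∸ 1)))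
  ; complete   = λ { hub → here refl
                   ; (blade i a) → there (∈-map⁺ just (∈-cartesianProduct⁺ (∈-allFin i) (∈-allFin a))) }
  ; Adj        = λ u v → u ≢ v × ∃ λ i → InCopy {n} {k} i u × InCopy {n} {k} i v
  ; adj?       = λ u v → ¬? (u ≟ʷ v) ×-dec Fin.any? (λ i → inCopy? {n} i u ×-dec inCopy? {n} i v)
  ; adj-sym    = λ (u≢v , i , p , q) → u≢v ∘ sym , i , q , p
  ; adj-irrefl = λ u≡v (u≢v , _) → u≢v u≡v
  }
  where
  _≟ʷ_ : DecidableEquality (WindmillVertex n k)
  _≟ʷ_ = Maybe.≡-dec (Product.≡-dec Fin._≟_ Fin._≟_)

  blades : List (Fin k × Fin (n ∸ 1))
  blades = cartesianProduct (allFin k) (allFin (n ∸ 1))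

  hub≢ : ∀ {v : WindmillVertex n k} → (∃ λ b → b ∈ blades × v ≡ just b) → hub ≢ v
  hub≢ (_ , _ , refl) ()

-- A finite subset of ℕ is represented by a list, in which order and
-- repetition are irrelevant: equality of subsets is _∼[ set ]_ and
-- cardinality discards duplicates.
FiniteSet : Set
FiniteSet = List ℕ

∣_∣ : FiniteSet → ℕ
∣ A ∣ = length (deduplicate _≟_ A)

infixl 6 _⊕_
_⊕_ : FiniteSet → FiniteSet → FiniteSet
_⊕_ = cartesianProductWith _+_

module _ (G : Graph) where
  open Graph G

  record IsIASI (f : Vertex → FiniteSet) : Set where
    field
      nonEmpty       : ∀ v → f v ≢ []
      injective      : ∀ {u v} → f u ∼[ set ] f v → u ≡ v
      edge-injective : ∀ {u v x y} → Adj u v → Adj x y →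
                       f u ⊕ f v ∼[ set ] f x ⊕ f y →
                       (u ≡ x × v ≡ y) ⊎ (u ≡ y × v ≡ x)

  record IsWIASI (f : Vertex → FiniteSet) : Set where
    field
      isIASI : IsIASI f
      weak   : ∀ {u v} → Adj u v → ∣ f u ⊕ f v ∣ ≡ ∣ f u ∣ ⊔ ∣ f v ∣

  monoIndexedEdges : (Vertex → FiniteSet) → ℕ
  monoIndexedEdges f =
    length (filter (λ (u , v) → ∣ f u ⊕ f v ∣ ≟ 1) (edges G))

  IsSparingNumber : ℕ → Set
  IsSparingNumber s =
    (∃ λ f → IsWIASI f × monoIndexedEdges f ≡ s) ×
    (∀ f → IsWIASI f → s ≤ monoIndexedEdges f)

{-# OPTIONS --safe #-}

-- Any two vertices of W(n,k) are joined by a walk of length at most 2 through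
-- the hub, so for r ≥ 2 the power is the complete graph on k(n-1)+1 vertices.
-- If |B| ≥ 2 then |A + B| > |A| (for b < b′ in B, adjoin max A + b′ to the
-- translate A + b), so in a weak IASI no edge has two non-singleton ends; in a
-- complete graph all vertices but at most one are therefore singletons, and the
-- edges between singletons are mono-indexed.  Conversely label the vertices by
-- {0,1}, {2}, {4}, {8}, …: the label of vertex i has maximum 2^i, maxima add up
-- under sumsets, and 2^i + 2^j with i ≠ j determines {i,j}.
module Submission where

open import Defs
open import Data.Nat using (ℕ; _*_; _∸_; _/_; _≤_)
open import Data.Fin using (Fin; zero; suc; toℕ)
import Data.Fin.Properties as Fin
open import Data.List using (List; []; _∷_; _++_; map; length; filter; deduplicate; cartesianProduct; allFin; lookup)
open import Data.List.Extrema.Nat using (max; argmax-sel; ⊥≤max; xs≤max)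
open import Data.List.Membership.Propositional using (_∈_)
open import Data.List.Membership.Propositional.Properties using (∈-map⁻; ∈-cartesianProductWith⁺; ∈-cartesianProductWith⁻; ∈-deduplicate⁺; ∈-deduplicate⁻; ∈-lookup)
open import Data.List.Membership.Setoid.Properties using (index-injective)
open import Data.List.Properties using (filter-++; filter-all; filter-none; filter-accept; length-++; length-map; length-filter; length-deduplicate; length-tabulate)
open import Data.List.Relation.Binary.BagAndSetEquality using (_∼[_]_; set)
open import Data.List.Relation.Binary.Subset.Propositional using (_⊆_)
open import Data.List.Relation.Unary.All as All using (All; []; _∷_)
import Data.List.Relation.Unary.All.Properties as All
open import Data.List.Relation.Unary.AllPairs as AllPairs using (AllPairs; []; _∷_)
open import Data.List.Relation.Unary.Any using (here; there; index)
open import Data.List.Relation.Unary.Unique.Propositional using (Unique)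
open import Data.List.Relation.Unary.Unique.Propositional.Properties using (map⁺)
open import Data.List.Relation.Unary.Unique.DecPropositional.Properties using (deduplicate-!)
open import Data.Nat using (zero; suc; pred; _+_; _^_; _⊔_; _<_; _≟_; z≤n; s≤s)
open import Data.Maybe using (just)
open import Data.Nat.DivMod using (m*n/n≡m)
open import Data.Nat.Properties
open import Data.Nat.Tactic.RingSolver using (solve-∀)
open import Data.Product using (∃; _×_; _,_; proj₁; proj₂; uncurry)
open import Data.Sum using (_⊎_; inj₁; inj₂; [_,_]′)
open import Function using (_∘_; id; Equivalence)
open import Level using (0ℓ)
open import Relation.Binary.Definitions using (tri<; tri≈; tri>)
open import Relation.Binary.PropositionalEquality using (_≡_; _≢_; refl; sym; trans; cong; cong₂; subst; setoid; module ≡-Reasoning)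
open import Relation.Nullary using (yes; no; ¬_; contradiction)
open import Relation.Unary using (Pred; Decidable)

private variable
  A : Set
  B C : FiniteSet

-- Lists

unique⇒lookup-injective : {xs : List A} → Unique xs → ∀ {i j} → lookup xs i ≡ lookup xs j → i ≡ j
unique⇒lookup-injective (_ ∷ _)    {zero}  {zero}  _  = refl
unique⇒lookup-injective (x∉xs ∷ _) {zero}  {suc j} eq = contradiction eq (All.lookup x∉xs (∈-lookup j))
unique⇒lookup-injective (x∉xs ∷ _) {suc i} {zero}  eq = contradiction (sym eq) (All.lookup x∉xs (∈-lookup i))
unique⇒lookup-injective (_ ∷ xs!)  {suc i} {suc j} eq = cong suc (unique⇒lookup-injective xs! eq)

-- Pigeonhole: sending a position in `xs` to the position of the same element in `ys` is injective,
-- since `xs` has no repetition.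
unique-⊆⇒length≤ : {xs ys : List A} → Unique xs → xs ⊆ ys → length xs ≤ length ys
unique-⊆⇒length≤ {xs = xs} xs! xs⊆ys =
  Fin.injective⇒≤ {f = λ i → index (xs⊆ys (∈-lookup {xs = xs} i))}
    λ eq → unique⇒lookup-injective xs! (index-injective (setoid _) (xs⊆ys _) (xs⊆ys _) eq)

unorderedPairs⁺ : {R : A → A → Set} {xs : List A} →
                  AllPairs R xs → All (uncurry R) (unorderedPairs xs)
unorderedPairs⁺ []         = []
unorderedPairs⁺ (rx ∷ rxs) = All.++⁺ (All.map⁺ rx) (unorderedPairs⁺ rxs)

length-unorderedPairs : (xs : List A) →
                        length (unorderedPairs xs) ≡ (length xs * (length xs ∸ 1)) / 2
length-unorderedPairs xs = begin
  -- Doubling first keeps the division out of the induction.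
  length (unorderedPairs xs)            ≡⟨ m*n/n≡m (length (unorderedPairs xs)) 2 ⟨
  (length (unorderedPairs xs) * 2) / 2  ≡⟨ cong (_/ 2) (doubled xs) ⟩
  (length xs * (length xs ∸ 1)) / 2     ∎
  where
  open ≡-Reasoning
  step : ∀ m → m * 2 + m * (m ∸ 1) ≡ suc m * m
  -- The case split lets `m ∸ 1` reduce, which leaves a pure semiring identity for the solver.
  step zero    = refl
  step (suc m) = identity m
    where
    identity : ∀ m → suc m * 2 + suc m * m ≡ suc (suc m) * suc m
    identity = solve-∀
  doubled : (xs : List A) → length (unorderedPairs xs) * 2 ≡ length xs * (length xs ∸ 1)
  doubled []       = refl
  doubled (x ∷ xs) = begin
    length (map (x ,_) xs ++ unorderedPairs xs) * 2
      ≡⟨ cong (_* 2) (trans (length-++ (map (x ,_) xs)) (cong (_+ _) (length-map (x ,_) xs))) ⟩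
    (length xs + length (unorderedPairs xs)) * 2
      ≡⟨ *-distribʳ-+ 2 (length xs) _ ⟩
    length xs * 2 + length (unorderedPairs xs) * 2
      ≡⟨ cong (length xs * 2 +_) (doubled xs) ⟩
    length xs * 2 + length xs * (length xs ∸ 1)
      ≡⟨ step (length xs) ⟩
    suc (length xs) * length xs ∎

length-filter-++-none : {Q : Pred A 0ℓ} (Q? : Decidable Q) {xs ys : List A} → All (¬_ ∘ Q) xs →
                        length (filter Q? (xs ++ ys)) ≤ length ys
length-filter-++-none Q? {xs} {ys} ¬qs = begin
  length (filter Q? (xs ++ ys))          ≡⟨ cong length (filter-++ Q? xs ys) ⟩
  length (filter Q? xs ++ filter Q? ys)  ≡⟨ cong (λ zs → length (zs ++ _)) (filter-none Q? ¬qs) ⟩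
  length (filter Q? ys)                  ≤⟨ length-filter Q? ys ⟩
  length ys                              ∎
  where open ≤-Reasoning

module _ {P : Pred A 0ℓ} {Q : Pred (A × A) 0ℓ} (P? : Decidable P) (Q? : Decidable Q)
         (P×P⇒Q : ∀ {x y} → P x → P y → Q (x , y)) where

  private
    count : List (A × A) → ℕ
    count ps = length (filter Q? ps)

    count-++ : ∀ ps qs → count (ps ++ qs) ≡ count ps + count qs
    count-++ ps qs = trans (cong length (filter-++ Q? ps qs)) (length-++ (filter Q? ps))

    OneOf : A → A → Set
    OneOf x y = P x ⊎ P y

    others : ∀ {x xs} → ¬ P x → All (OneOf x) xs → All P xs
    others ¬px = All.map [ (λ px → contradiction px ¬px) , id ]′

    count-star-all : ∀ {x xs} → P x → All P xs → count (map (x ,_) xs) ≡ length xs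
    count-star-all {x} {xs} px pxs = trans
      (cong length (filter-all Q? (All.map⁺ (All.map (P×P⇒Q px) pxs))))
      (length-map (x ,_) xs)

    -- At most one entry of `xs` fails `P`, so at most one pair of the star at `x` can be lost;
    -- hence the `pred`.
    count-star : ∀ {x xs} → P x → AllPairs OneOf xs → pred (length xs) ≤ count (map (x ,_) xs)
    count-star px [] = z≤n
    count-star {x} {y ∷ ys} px (oy ∷ oys) with P? y
    ... | no ¬py = begin
      length ys                                     ≡⟨ count-star-all px (others ¬py oy) ⟨
      count (map (x ,_) ys)                         ≤⟨ m≤n+m _ _ ⟩
      count ((x , y) ∷ []) + count (map (x ,_) ys)  ≡⟨ count-++ ((x , y) ∷ []) _ ⟨
      count (map (x ,_) (y ∷ ys))                   ∎
      where open ≤-Reasoning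
    ... | yes py = begin
      length ys                    ≤⟨ suc-pred-≤ (length ys) ⟩
      suc (pred (length ys))       ≤⟨ s≤s (count-star px oys) ⟩
      suc (count (map (x ,_) ys))  ≡⟨ cong length (filter-accept Q? (P×P⇒Q px py)) ⟨
      count (map (x ,_) (y ∷ ys))  ∎
      where
      open ≤-Reasoning
      suc-pred-≤ : ∀ m → m ≤ suc (pred m)
      suc-pred-≤ zero    = z≤n
      suc-pred-≤ (suc m) = ≤-refl

  -- At most one entry fails `P`. If it is `x`, every pair inside `xs` is counted. Otherwise, for
  -- `xs = y ∷ ys`, the star at `x` contributes at least `length ys`, as many pairs as the star of
  -- `y` has in `y ∷ ys`, and induction supplies the pairs of `ys`.
  length-filter-unorderedPairs :
    ∀ {x xs} → AllPairs (λ u v → P u ⊎ P v) (x ∷ xs) →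
    length (unorderedPairs xs) ≤ length (filter Q? (unorderedPairs (x ∷ xs)))
  length-filter-unorderedPairs {x} {xs} (ox ∷ oxs) with P? x
  ... | no ¬px = begin
    length (unorderedPairs xs)
      ≡⟨ cong length (filter-all Q? (All.map (uncurry P×P⇒Q) (unorderedPairs⁺ (pairs (others ¬px ox))))) ⟨
    count (unorderedPairs xs)
      ≤⟨ m≤n+m _ _ ⟩
    count (map (x ,_) xs) + count (unorderedPairs xs)
      ≡⟨ count-++ (map (x ,_) xs) _ ⟨
    count (unorderedPairs (x ∷ xs)) ∎
    where
    open ≤-Reasoning
    pairs : ∀ {xs} → All P xs → AllPairs (λ u v → P u × P v) xs
    pairs []         = []
    pairs (px ∷ pxs) = All.map (px ,_) pxs ∷ pairs pxs
  length-filter-unorderedPairs {x} {[]}     _          | yes px = z≤n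
  length-filter-unorderedPairs {x} {y ∷ ys} (ox ∷ oxs) | yes px = begin
    length (unorderedPairs (y ∷ ys))
      ≡⟨ trans (length-++ (map (y ,_) ys)) (cong (_+ _) (length-map (y ,_) ys)) ⟩
    length ys + length (unorderedPairs ys)
      ≤⟨ +-mono-≤ (count-star px oxs) (length-filter-unorderedPairs oxs) ⟩
    count (map (x ,_) (y ∷ ys)) + count (unorderedPairs (y ∷ ys))
      ≡⟨ count-++ (map (x ,_) (y ∷ ys)) _ ⟨
    count (unorderedPairs (x ∷ y ∷ ys)) ∎
    where open ≤-Reasoning

-- Cardinalities of sumsets

unique-⊆⇒length≤∣∣ : ∀ {xs} → Unique xs → xs ⊆ B → length xs ≤ ∣ B ∣
unique-⊆⇒length≤∣∣ xs! xs⊆B = unique-⊆⇒length≤ xs! (∈-deduplicate⁺ _≟_ ∘ xs⊆B)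

∣∣-mono-⊆ : B ⊆ C → ∣ B ∣ ≤ ∣ C ∣
∣∣-mono-⊆ {B} B⊆C = unique-⊆⇒length≤∣∣ (deduplicate-! _≟_ B) (B⊆C ∘ ∈-deduplicate⁻ _≟_ B)

unique⇒∣∣≡length : Unique B → ∣ B ∣ ≡ length B
unique⇒∣∣≡length {B} B! = ≤-antisym (length-deduplicate _≟_ B) (unique-⊆⇒length≤∣∣ B! id)

nonEmpty⇒1≤∣∣ : B ≢ [] → 1 ≤ ∣ B ∣
nonEmpty⇒1≤∣∣ {[]}    B≢[] = contradiction refl B≢[]
nonEmpty⇒1≤∣∣ {_ ∷ _} _    = s≤s z≤n

-- Stated through membership alone, so that it is invariant under `_∼[ set ]_`: the maximum serves
-- to tell labels apart.
IsMax : ℕ → FiniteSet → Set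
IsMax m B = m ∈ B × (∀ {b} → b ∈ B → b ≤ m)

maximum : B ≢ [] → ∃ λ m → IsMax m B
maximum {[]}     B≢[] = contradiction refl B≢[]
maximum {b ∷ bs} _    =
  max b bs , [ here , there ]′ (argmax-sel id b bs) , All.lookup (⊥≤max b bs ∷ xs≤max b bs)

isMax-⊕ : ∀ {m n} → IsMax m B → IsMax n C → IsMax (m + n) (B ⊕ C)
isMax-⊕ {B} {C} (m∈B , B≤m) (n∈C , C≤n) = ∈-cartesianProductWith⁺ _+_ m∈B n∈C , bound
  where
  bound : ∀ {x} → x ∈ B ⊕ C → x ≤ _
  bound x∈ with _ , _ , b∈B , c∈C , refl ← ∈-cartesianProductWith⁻ _+_ B C x∈ =
    +-mono-≤ (B≤m b∈B) (C≤n c∈C)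

isMax-unique : ∀ {m n} → B ∼[ set ] C → IsMax m B → IsMax n C → m ≡ n
isMax-unique B∼C (m∈B , B≤m) (n∈C , C≤n) =
  ≤-antisym (C≤n (Equivalence.to B∼C m∈B)) (B≤m (Equivalence.from B∼C n∈C))

∣∣<∣⊕∣ : B ≢ [] → ∀ {c c′} → c ∈ C → c′ ∈ C → c < c′ → ∣ B ∣ < ∣ B ⊕ C ∣
∣∣<∣⊕∣ {B} {C} B≢[] {c} {c′} c∈C c′∈C c<c′ = begin-strict
  ∣ B ∣                  ≡⟨ length-map (_+ c) D ⟨
  length (map (_+ c) D)  <⟨ unique-⊆⇒length≤∣∣ unique′ ⊆-⊕ ⟩
  ∣ B ⊕ C ∣              ∎
  where
  open ≤-Reasoning
  D : FiniteSet
  D = deduplicate _≟_ B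
  m : ℕ
  m = proj₁ (maximum B≢[])
  m-max : IsMax m B
  m-max = proj₂ (maximum B≢[])
  -- `m + c′` lies strictly above the whole translate of `D` by `c`, because `b ≤ m` and `c < c′`.
  new : ∀ {x} → x ∈ map (_+ c) D → m + c′ ≢ x
  new x∈ with _ , b∈D , refl ← ∈-map⁻ (_+ c) x∈ =
    >⇒≢ (+-mono-≤-< (proj₂ m-max (∈-deduplicate⁻ _≟_ B b∈D)) c<c′)
  unique′ : Unique (m + c′ ∷ map (_+ c) D)
  unique′ = All.tabulate new ∷ map⁺ (+-cancelʳ-≡ c _ _) (deduplicate-! _≟_ B)
  ⊆-⊕ : m + c′ ∷ map (_+ c) D ⊆ B ⊕ C
  ⊆-⊕ (here refl) = ∈-cartesianProductWith⁺ _+_ (proj₁ m-max) c′∈C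
  ⊆-⊕ (there x∈) with _ , b∈D , refl ← ∈-map⁻ (_+ c) x∈ =
    ∈-cartesianProductWith⁺ _+_ (∈-deduplicate⁻ _≟_ B b∈D) c∈C

⊕-comm-⊆ : ∀ B C → B ⊕ C ⊆ C ⊕ B
⊕-comm-⊆ B C x∈ with b , c , b∈B , c∈C , refl ← ∈-cartesianProductWith⁻ _+_ B C x∈ =
  subst (_∈ C ⊕ B) (+-comm c b) (∈-cartesianProductWith⁺ _+_ c∈C b∈B)

singleton-or-∣⊕∣-grows : B ≢ [] → C ≢ [] → ∣ C ∣ ≡ 1 ⊎ ∣ B ∣ < ∣ B ⊕ C ∣
singleton-or-∣⊕∣-grows {C = C} B≢[] C≢[]
  -- The four terms are abstracted together so that splitting the list refines the facts about it;
  -- the empty list is excluded by `1 ≤ 0`. Two distinct entries, once ordered, feed the growth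
  -- lemma.
  with deduplicate _≟_ C | deduplicate-! _≟_ C | ∈-deduplicate⁻ _≟_ C | nonEmpty⇒1≤∣∣ C≢[]
... | _ ∷ []    | _             | _   | _ = inj₁ refl
... | c ∷ d ∷ _ | (c≢d ∷ _) ∷ _ | D⊆C | _ with <-cmp c d
...   | tri< c<d _ _ = inj₂ (∣∣<∣⊕∣ B≢[] (D⊆C (here refl)) (D⊆C (there (here refl))) c<d)
...   | tri≈ _ c≡d _ = contradiction c≡d c≢d
...   | tri> _ _ d<c = inj₂ (∣∣<∣⊕∣ B≢[] (D⊆C (there (here refl))) (D⊆C (here refl)) d<c)

singleton : ∣ B ∣ ≡ 1 → ∃ λ b → b ∈ B × B ⊆ b ∷ []
singleton {B} _ with deduplicate _≟_ B | ∈-deduplicate⁻ _≟_ B | (λ {x} → ∈-deduplicate⁺ _≟_ {B} {x})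
... | b ∷ [] | D⊆B | B⊆D = b , D⊆B (here refl) , B⊆D

∣⊕∣≡1 : ∣ B ∣ ≡ 1 → ∣ C ∣ ≡ 1 → ∣ B ⊕ C ∣ ≡ 1
∣⊕∣≡1 {B} {C} ∣B∣≡1 ∣C∣≡1
  with b , b∈B , B⊆ ← singleton ∣B∣≡1 | c , c∈C , C⊆ ← singleton ∣C∣≡1
  = ≤-antisym (∣∣-mono-⊆ {C = b + c ∷ []} ⊆[b+c])
    (∣∣-mono-⊆ {b + c ∷ []} λ { (here refl) → ∈-cartesianProductWith⁺ _+_ b∈B c∈C })
  where
  ⊆[b+c] : B ⊕ C ⊆ b + c ∷ []
  ⊆[b+c] x∈ with _ , _ , b′∈B , c′∈C , refl ← ∈-cartesianProductWith⁻ _+_ B C x∈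
    with here refl ← B⊆ b′∈B | here refl ← C⊆ c′∈C = here refl

weak⇒singleton : B ≢ [] → C ≢ [] → ∣ B ⊕ C ∣ ≡ ∣ B ∣ ⊔ ∣ C ∣ → ∣ B ∣ ≡ 1 ⊎ ∣ C ∣ ≡ 1
weak⇒singleton {B} {C} B≢[] C≢[] weak
  with singleton-or-∣⊕∣-grows B≢[] C≢[] | singleton-or-∣⊕∣-grows C≢[] B≢[]
... | inj₁ ∣C∣≡1   | _            = inj₂ ∣C∣≡1
... | inj₂ _       | inj₁ ∣B∣≡1   = inj₁ ∣B∣≡1
-- The second growth concerns `C ⊕ B` and is carried over by commutativity; the sumset then exceeds
-- both cardinalities, hence their maximum.
... | inj₂ ∣B∣<∣⊕∣ | inj₂ ∣C∣<∣⊕∣ = contradiction (sym weak)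
  (<⇒≢ (⊔-lub ∣B∣<∣⊕∣ (≤-trans ∣C∣<∣⊕∣ (∣∣-mono-⊆ (⊕-comm-⊆ C B)))))

-- Weak IASIs of complete graphs

-- Index 0 is the only one with two elements, and its maximum still fits the formula `2 ^ i`. The
-- maximum is listed first in every label.
label : ℕ → FiniteSet
label zero    = 1 ∷ 0 ∷ []
label (suc i) = 2 ^ suc i ∷ []

isMax-label : ∀ i → IsMax (2 ^ i) (label i)
isMax-label zero    = here refl , λ { (here refl) → ≤-refl ; (there (here refl)) → z≤n }
isMax-label (suc i) = here refl , λ { (here refl) → ≤-refl }

2^-injective : ∀ {i j} → 2 ^ i ≡ 2 ^ j → i ≡ j
2^-injective {i} {j} eq with <-cmp i j
... | tri< i<j _ _ = contradiction eq (<⇒≢ (^-monoʳ-< 2 (s≤s (s≤s z≤n)) i<j))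
... | tri≈ _ i≡j _ = i≡j
... | tri> _ _ j<i = contradiction eq (>⇒≢ (^-monoʳ-< 2 (s≤s (s≤s z≤n)) j<i))

2^i+2^j<2^l : ∀ {i j l} → i < j → j < l → 2 ^ i + 2 ^ j < 2 ^ l
2^i+2^j<2^l {i} {j} {l} i<j j<l = begin-strict
  2 ^ i + 2 ^ j  <⟨ +-monoˡ-< (2 ^ j) (^-monoʳ-< 2 (s≤s (s≤s z≤n)) i<j) ⟩
  2 ^ j + 2 ^ j  ≡⟨ cong (2 ^ j +_) (+-identityʳ (2 ^ j)) ⟨
  2 ^ suc j      ≤⟨ ^-monoʳ-≤ 2 j<l ⟩
  2 ^ l          ∎
  where open ≤-Reasoning

-- Uniqueness of binary expansions with two digits 1: the side with the larger top exponent would be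
-- strictly larger, so the top exponents agree and cancel.
2^+2^-ordered : ∀ {i j k l} → i < j → k < l → 2 ^ i + 2 ^ j ≡ 2 ^ k + 2 ^ l → i ≡ k × j ≡ l
2^+2^-ordered {i} {j} {k} {l} i<j k<l eq with <-cmp j l
... | tri< j<l _ _ = contradiction eq (<⇒≢ (<-≤-trans (2^i+2^j<2^l i<j j<l) (m≤n+m _ _)))
... | tri≈ _ refl _ = 2^-injective (+-cancelʳ-≡ (2 ^ j) _ _ eq) , refl
... | tri> _ _ l<j = contradiction eq (>⇒≢ (<-≤-trans (2^i+2^j<2^l k<l l<j) (m≤n+m _ _)))

2^+2^-injective : ∀ {i j k l} → i ≢ j → k ≢ l → 2 ^ i + 2 ^ j ≡ 2 ^ k + 2 ^ l →
                  (i ≡ k × j ≡ l) ⊎ (i ≡ l × j ≡ k)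
2^+2^-injective {i} {j} {k} {l} i≢j k≢l eq with <-cmp i j | <-cmp k l
... | tri≈ _ i≡j _ | _            = contradiction i≡j i≢j
... | _            | tri≈ _ k≡l _ = contradiction k≡l k≢l
... | tri< i<j _ _ | tri< k<l _ _ = inj₁ (2^+2^-ordered i<j k<l eq)
... | tri< i<j _ _ | tri> _ _ l<k = inj₂ (2^+2^-ordered i<j l<k (trans eq (+-comm (2 ^ k) _)))
... | tri> _ _ j<i | tri< k<l _ _ =
  let j≡k , i≡l = 2^+2^-ordered j<i k<l (trans (+-comm (2 ^ j) _) eq) in inj₂ (i≡l , j≡k)
... | tri> _ _ j<i | tri> _ _ l<k =
  let j≡l , i≡k = 2^+2^-ordered j<i l<k (trans (+-comm (2 ^ j) _) (trans eq (+-comm (2 ^ k) _)))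
  in inj₁ (i≡k , j≡l)

label-nonEmpty : ∀ i → label i ≢ []
label-nonEmpty zero    ()
label-nonEmpty (suc i) ()

label-injective : ∀ {i j} → label i ∼[ set ] label j → i ≡ j
label-injective {i} {j} eq = 2^-injective (isMax-unique eq (isMax-label i) (isMax-label j))

label-⊕-injective : ∀ {i j k l} → i ≢ j → k ≢ l → label i ⊕ label j ∼[ set ] label k ⊕ label l →
                    (i ≡ k × j ≡ l) ⊎ (i ≡ l × j ≡ k)
label-⊕-injective {i} {j} {k} {l} i≢j k≢l eq = 2^+2^-injective i≢j k≢l
  (isMax-unique eq (isMax-⊕ (isMax-label i) (isMax-label j)) (isMax-⊕ (isMax-label k) (isMax-label l)))

label-weak : ∀ {i j} → i ≢ j → ∣ label i ⊕ label j ∣ ≡ ∣ label i ∣ ⊔ ∣ label j ∣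
label-weak {zero}  {zero}  i≢j = contradiction refl i≢j
-- `deduplicate` is stuck on comparing open terms, so the distinctness of the two translated
-- elements is supplied by hand.
label-weak {zero}  {suc j} _   = unique⇒∣∣≡length {label 0 ⊕ label (suc j)} ((>⇒≢ (n<1+n _) ∷ []) ∷ [] ∷ [])
label-weak {suc i} {zero}  _   = unique⇒∣∣≡length {label (suc i) ⊕ label 0}
  ((>⇒≢ (+-monoʳ-< (2 ^ suc i) (n<1+n 0)) ∷ []) ∷ [] ∷ [])
label-weak {suc i} {suc j} _   = refl

-- Adding a two-element set strictly enlarges `label i`, which already has at least one element.
label-zero-⊕ : ∀ i → ∣ label 0 ⊕ label i ∣ ≢ 1
label-zero-⊕ i eq = contradiction (subst (∣ label i ∣ <_) eq grows) (≤⇒≯ (nonEmpty⇒1≤∣∣ (label-nonEmpty i)))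
  where
  grows : ∣ label i ∣ < ∣ label 0 ⊕ label i ∣
  grows = ≤-trans
    (∣∣<∣⊕∣ (label-nonEmpty i) {0} {1} (there (here refl)) (here refl) (n<1+n 0))
    (∣∣-mono-⊆ (⊕-comm-⊆ (label i) (label 0)))

-- The head `x` of the vertex list is split off to carry the two-element label; the sparing number
-- is then the number of pairs within `xs`.
module CompleteGraph (G : Graph) (all-adjacent : ∀ {u v} → u ≢ v → Graph.Adj G u v)
                     {x} {xs} (vertices≡ : Graph.vertices G ≡ x ∷ xs) where
  open Graph G

  private
    vertices! : Unique (x ∷ xs)
    vertices! = subst Unique vertices≡ unique

    edges≡ : edges G ≡ unorderedPairs (x ∷ xs)
    edges≡ = trans
      (filter-all _ (unorderedPairs⁺ (AllPairs.map all-adjacent unique)))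
      (cong unorderedPairs vertices≡)

    adjacent⇒≢ : ∀ {u v} → Adj u v → u ≢ v
    adjacent⇒≢ uv u≡v = adj-irrefl u≡v uv

    Mono : (Vertex → FiniteSet) → Pred (Vertex × Vertex) 0ℓ
    Mono f (u , v) = ∣ f u ⊕ f v ∣ ≡ 1

    mono? : ∀ f → Decidable (Mono f)
    mono? f (u , v) = ∣ f u ⊕ f v ∣ ≟ 1

    monoIndexedEdges≡ : ∀ f → monoIndexedEdges G f ≡ length (filter (mono? f) (unorderedPairs (x ∷ xs)))
    monoIndexedEdges≡ f = cong (length ∘ filter (mono? f)) edges≡

  lower-bound : ∀ f → IsWIASI G f → length (unorderedPairs xs) ≤ monoIndexedEdges G f
  lower-bound f wiasi = subst (length (unorderedPairs xs) ≤_) (sym (monoIndexedEdges≡ f))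
    -- Here `P` is having a singleton label and `Q` is being mono-indexed; completeness makes
    -- `one-mono` available for every pair.
    (length-filter-unorderedPairs (λ v → ∣ f v ∣ ≟ 1) (mono? f)
      (λ {u} {v} → ∣⊕∣≡1 {f u} {f v}) (AllPairs.map one-mono vertices!))
    where
    open IsWIASI wiasi
    open IsIASI isIASI
    one-mono : ∀ {u v} → u ≢ v → ∣ f u ∣ ≡ 1 ⊎ ∣ f v ∣ ≡ 1
    one-mono u≢v = weak⇒singleton (nonEmpty _) (nonEmpty _) (weak (all-adjacent u≢v))

  position : ∀ v → v ∈ x ∷ xs
  position v = subst (v ∈_) vertices≡ (complete v)

  rank : Vertex → ℕ
  rank v = toℕ (index (position v))

  rank-injective : ∀ {u v} → rank u ≡ rank v → u ≡ v
  rank-injective {u} {v} eq =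
    index-injective (setoid _) (position u) (position v) (Fin.toℕ-injective eq)

  -- A priori `complete x` could point into `xs`; distinctness of the vertices rules this out. So
  -- `x` receives `label 0`.
  rank-x : rank x ≡ 0
  rank-x with position x
  ... | here _     = refl
  ... | there x∈xs = contradiction refl (All.lookup (AllPairs.head vertices!) x∈xs)

  labelling : Vertex → FiniteSet
  labelling = label ∘ rank

  labelling-isWIASI : IsWIASI G labelling
  labelling-isWIASI = record
    { isIASI = record
      { nonEmpty       = label-nonEmpty ∘ rank
      ; injective      = rank-injective ∘ label-injective
      ; edge-injective = λ uv xy eq →
          [ (λ (p , q) → inj₁ (rank-injective p , rank-injective q))
          , (λ (p , q) → inj₂ (rank-injective p , rank-injective q)) ]′
          (label-⊕-injective (ranks≢ uv) (ranks≢ xy) eq)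
      }
    ; weak = label-weak ∘ ranks≢
    }
    where
    ranks≢ : ∀ {u v} → Adj u v → rank u ≢ rank v
    ranks≢ uv = adjacent⇒≢ uv ∘ rank-injective

  -- No pair at `x` is mono-indexed, so only pairs within `xs` can count. The reverse inequality is
  -- an instance of `lower-bound`.
  labelling-mono≤ : monoIndexedEdges G labelling ≤ length (unorderedPairs xs)
  labelling-mono≤ = subst (_≤ length (unorderedPairs xs)) (sym (monoIndexedEdges≡ labelling))
    (length-filter-++-none (mono? labelling) {map (x ,_) xs} {unorderedPairs xs}
      (All.map⁺ (All.universal ¬mono-at-x xs)))
    where
    ¬mono-at-x : ∀ v → ∣ labelling x ⊕ labelling v ∣ ≢ 1
    ¬mono-at-x v = subst (λ i → ∣ label i ⊕ labelling v ∣ ≢ 1) (sym rank-x) (label-zero-⊕ (rank v))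

  sparingNumber : IsSparingNumber G (length (unorderedPairs xs))
  sparingNumber =
    (labelling , labelling-isWIASI ,
      ≤-antisym labelling-mono≤ (lower-bound labelling labelling-isWIASI)) ,
    lower-bound

-- Powers of windmill graphs

-- `DistanceAtMost` asks for the exact distance, hence the split on adjacency: it is 1 for adjacent
-- vertices; otherwise both differ from the universal vertex `h`, and the walk through `h` shows
-- that it is 2.
power-complete : (G : Graph) (let open Graph G) {h : Vertex} → (∀ {v} → v ≢ h → Adj v h) →
                 ∀ {r} → 2 ≤ r → ∀ {u v} → u ≢ v → Graph.Adj (power G r) u v
power-complete G {h} universal 2≤r {u} {v} u≢v with Graph.adj? G u v
... | yes uv = u≢v , 1 , ≤-trans (n≤1+n 1) 2≤r , uv ∷ [] ,
  λ { [] → contradiction refl u≢v ; (_ ∷ _) → s≤s z≤n }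
... | no ¬uv = u≢v , 2 , 2≤r , universal u≢h ∷ adj-sym (universal v≢h) ∷ [] ,
  λ { [] → contradiction refl u≢v
    ; (uv ∷ []) → contradiction uv ¬uv
    ; (_ ∷ _ ∷ _) → s≤s (s≤s z≤n) }
  where
  open Graph G
  u≢h : u ≢ h
  u≢h refl = ¬uv (adj-sym (universal (u≢v ∘ sym)))
  v≢h : v ≢ h
  v≢h refl = ¬uv (universal u≢v)

hub-universal : ∀ {n k v} → v ≢ hub → Graph.Adj (windmill n k) v hub
hub-universal {v = hub}       v≢hub = contradiction refl v≢hub
hub-universal {v = blade i a} v≢hub = v≢hub , i , blade∈ , hub∈

length-cartesianProduct : {X Y : Set} (xs : List X) (ys : List Y) →
                          length (cartesianProduct xs ys) ≡ length xs * length ys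
length-cartesianProduct []       ys = refl
length-cartesianProduct (x ∷ xs) ys = trans (length-++ (map (x ,_) ys))
  (cong₂ _+_ (length-map (x ,_) ys) (length-cartesianProduct xs ys))

mainTheorem8 : (n k : ℕ) → 2 ≤ n → 2 ≤ k → (r : ℕ) → 2 ≤ r →
    IsSparingNumber (power (windmill n k) r) ((k * (n ∸ 1) * (k * (n ∸ 1) ∸ 1)) / 2)
mainTheorem8 n k _ _ r 2≤r = subst (IsSparingNumber (power (windmill n k) r)) size
  (CompleteGraph.sparingNumber (power (windmill n k) r)
    -- Taking a power keeps the vertex list, so `refl` fixes `x` as the hub and `xs` as the
    -- `k * (n ∸ 1)` blade vertices.
    (power-complete (windmill n k) hub-universal 2≤r) refl)
  where
  open ≡-Reasoning
  blades : List (Fin k × Fin (n ∸ 1))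
  blades = cartesianProduct (allFin k) (allFin (n ∸ 1))
  length-allFin : ∀ m → length (allFin m) ≡ m
  length-allFin m = length-tabulate {n = m} id
  length-blades : length (map just blades) ≡ k * (n ∸ 1)
  length-blades = begin
    length (map just blades)                      ≡⟨ length-map just blades ⟩
    length blades                                 ≡⟨ length-cartesianProduct (allFin k) (allFin (n ∸ 1)) ⟩
    length (allFin k) * length (allFin (n ∸ 1))   ≡⟨ cong₂ _*_ (length-allFin k) (length-allFin (n ∸ 1)) ⟩
    k * (n ∸ 1)                                   ∎
  size : length (unorderedPairs (map just blades)) ≡ (k * (n ∸ 1) * (k * (n ∸ 1) ∸ 1)) / 2
  size = trans (length-unorderedPairs (map just blades)) (cong (λ m → (m * (m ∸ 1)) / 2) length-blades)
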